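{- Let $m \geq 1$ and $n\ge 3$ be integers. If $n \geq 3$ is odd, then \[\mathrm{ParseWords}(\mathrm{LeftTurnTree}(m, n), \mathrm{RightTurnTree}(1, m + n - 1)) = \{0\, 0\, 1^{n-3}\, 2\, 0^m,\; 0\, 2\, 1^{n-3}\, 0\, 0^m\},\] and if $n \geq 4$ is even, then \[\mathrm{ParseWords}(\mathrm{LeftTurnTree}(m, n), \mathrm{RightTurnTree}(1, m + n - 1)) = \{0\, 2\, 1^{n-3}\, 2\, 0^m,\; 0\, 0\, 1^{n-3}\, 0\, 0^m\}.\] (Sets of equivalence classes are written by listing one representative of each class; exponents denote repeated concatenation.)
   Context: A binary tree is a rooted ordered tree in which each vertex has either $0$ or $2$ children; its leaves are ordered left to right. Let $G$ be the context-free grammar with start symbols $0,1,2$ and rules $0\to 12$, $0\to 21$, $1\to 02$, $1\to 20$, $2\to 01$, $2\to 10$. An $n$-leaf binary tree $T$ parses a word $w$ of length $n$ on $\{0,1,2\}$ if there is a labeling of the vertices of $T$ by $0,1,2$ such that the leaves, from left to right, are labeled with the letters of $w$, and at every internal vertex the label of the vertex together with the labels of its left and right children form a rule of $G$ (i.e. the three labels are pairwise distinct). If $T$ parses $w$, it also parses every word obtained from $w$ by permuting the alphabet $\{0,1,2\}$. For $n$-leaf binary trees $T_1,T_2$, $\mathrm{ParseWords}(T_1,T_2)$ denotes the set of equivalence classes (under permutations of the alphabet $\{0,1,2\}$) of words parsed by both $T_1$ and $T_2$; it is written by listing one representative of each class. The level of a vertex is its distance from the root. A path tree is a binary tree with at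 most two vertices on each level. For $N\ge 2$, $N$-leaf path trees correspond bijectively to words $x_1\cdots x_{N-2}$ on $\{l,r\}$: $x_j=l$ (resp. $x_j=r$) means that, of the two vertices on level $j$, the left (resp. right) one has children. $\mathrm{LeftTurnTree}(m,n)$ is the $(m+n)$-leaf path tree corresponding to $l^m r^{n-2}$, and $\mathrm{RightTurnTree}(m,n)$ is the $(m+n)$-leaf path tree corresponding to $r^m l^{n-2}$. -}

module Defs where

open import Data.Nat.Base using (ℕ; zero; suc; _+_; _∸_; _≤_; z≤n; s≤s)
open import Data.Nat.Properties using (+-assoc; +-comm; +-identityʳ; m∸n+n≡m)
open import Data.Fin.Base using (Fin)
open import Data.Fin.Patterns using (0F; 1F; 2F)
open import Data.Fin.Permutation as Perm using (Permutation′; _⟨$⟩ʳ_; _∘ₚ_)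
open import Data.List.Base using (List; []; _∷_; _++_; [_]; map; replicate; length)
open import Data.List.Properties using (map-++; map-id; map-∘; map-cong; length-++; length-replicate)
open import Data.Product.Base using (_×_; _,_; ∃-syntax; Σ-syntax)
open import Data.Unit.Base using (⊤; tt)
open import Data.Empty using (⊥-elim)
open import Function.Bundles using (Injection)
open import Function.Properties.Inverse using (↔⇒↣)
open import Level using (0ℓ)
open import Relation.Binary.Bundles using (Setoid)
open import Relation.Binary.Definitions using (_Respects_)
open import Relation.Binary.PropositionalEquality
  using (_≡_; _≢_; refl; sym; trans; cong; cong₂; module ≡-Reasoning)
open import Relation.Unary using (Pred)
import Data.List.Membership.Setoid as Membership

Letter : Set
Letter = Fin 3

Word : Set
Word = List Letter

-- Rule a b c is the production a → b c.
data Rule : Letter → Letter → Letter → Set where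
  0→12 : Rule 0F 1F 2F
  0→21 : Rule 0F 2F 1F
  1→02 : Rule 1F 0F 2F
  1→20 : Rule 1F 2F 0F
  2→01 : Rule 2F 0F 1F
  2→10 : Rule 2F 1F 0F

data Tree : Set where
  leaf : Tree
  node : Tree → Tree → Tree

leaves : Tree → ℕ
leaves leaf       = 1
leaves (node s t) = leaves s + leaves t

data Labeling : Tree → Set where
  leaf : Letter → Labeling leaf
  node : ∀ {s t} → Letter → Labeling s → Labeling t → Labeling (node s t)

rootLabel : ∀ {t} → Labeling t → Letter
rootLabel (leaf a)     = a
rootLabel (node a _ _) = a

leafWord : ∀ {t} → Labeling t → Word
leafWord (leaf a)     = [ a ]
leafWord (node _ x y) = leafWord x ++ leafWord y

Valid : ∀ {t} → Labeling t → Set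
Valid (leaf _)     = ⊤
Valid (node a x y) = Rule a (rootLabel x) (rootLabel y) × Valid x × Valid y

-- No length condition is needed on w: leafWord always has length `leaves t`.
Parses : Tree → Word → Set
Parses t w = Σ[ x ∈ Labeling t ] (leafWord x ≡ w × Valid x)

permute : Permutation′ 3 → Word → Word
permute σ = map (σ ⟨$⟩ʳ_)

infix 4 _∼_

_∼_ : Word → Word → Set
u ∼ v = ∃[ σ ] permute σ u ≡ v

∼-refl : ∀ {u} → u ∼ u
∼-refl {u} = Perm.id , map-id u

∼-sym : ∀ {u v} → u ∼ v → v ∼ u
∼-sym {u} (σ , refl) = Perm.flip σ , trans (sym (map-∘ u))
  (trans (map-cong (λ _ → Perm.inverseˡ σ) u) (map-id u))

∼-trans : ∀ {u v w} → u ∼ v → v ∼ w → u ∼ w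
∼-trans {u} (σ , refl) (τ , refl) = σ ∘ₚ τ , map-∘ u

-- Words up to permutation of the alphabet.
wordClasses : Setoid 0ℓ 0ℓ
wordClasses = record
  { Carrier       = Word
  ; _≈_           = _∼_
  ; isEquivalence = record { refl = ∼-refl ; sym = ∼-sym ; trans = ∼-trans }
  }

-- A set of equivalence classes is a predicate on words that respects _∼_;
-- for ParseWords this is ParseWords-resp below.
ParseWords : Tree → Tree → Pred Word 0ℓ
ParseWords t₁ t₂ w = Parses t₁ w × Parses t₂ w

classesOf : List Word → Pred Word 0ℓ
classesOf reps w = w ∈ reps
  where open Membership wordClasses using (_∈_)

Rule-distinct : ∀ {a b c} → Rule a b c → a ≢ b × b ≢ c × a ≢ c
Rule-distinct 0→12 = (λ ()) , (λ ()) , (λ ())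
Rule-distinct 0→21 = (λ ()) , (λ ()) , (λ ())
Rule-distinct 1→02 = (λ ()) , (λ ()) , (λ ())
Rule-distinct 1→20 = (λ ()) , (λ ()) , (λ ())
Rule-distinct 2→01 = (λ ()) , (λ ()) , (λ ())
Rule-distinct 2→10 = (λ ()) , (λ ()) , (λ ())

distinct-Rule : ∀ a b c → a ≢ b → b ≢ c → a ≢ c → Rule a b c
distinct-Rule 0F 0F _  p _ _ = ⊥-elim (p refl)
distinct-Rule 0F 1F 0F _ _ r = ⊥-elim (r refl)
distinct-Rule 0F 1F 1F _ q _ = ⊥-elim (q refl)
distinct-Rule 0F 1F 2F _ _ _ = 0→12
distinct-Rule 0F 2F 0F _ _ r = ⊥-elim (r refl)
distinct-Rule 0F 2F 1F _ _ _ = 0→21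
distinct-Rule 0F 2F 2F _ q _ = ⊥-elim (q refl)
distinct-Rule 1F 0F 0F _ q _ = ⊥-elim (q refl)
distinct-Rule 1F 0F 1F _ _ r = ⊥-elim (r refl)
distinct-Rule 1F 0F 2F _ _ _ = 1→02
distinct-Rule 1F 1F _  p _ _ = ⊥-elim (p refl)
distinct-Rule 1F 2F 0F _ _ _ = 1→20
distinct-Rule 1F 2F 1F _ _ r = ⊥-elim (r refl)
distinct-Rule 1F 2F 2F _ q _ = ⊥-elim (q refl)
distinct-Rule 2F 0F 0F _ q _ = ⊥-elim (q refl)
distinct-Rule 2F 0F 1F _ _ _ = 2→01
distinct-Rule 2F 0F 2F _ _ r = ⊥-elim (r refl)
distinct-Rule 2F 1F 0F _ _ _ = 2→10
distinct-Rule 2F 1F 1F _ q _ = ⊥-elim (q refl)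
distinct-Rule 2F 1F 2F _ _ r = ⊥-elim (r refl)
distinct-Rule 2F 2F _  p _ _ = ⊥-elim (p refl)

Rule-permute : ∀ σ {a b c} → Rule a b c → Rule (σ ⟨$⟩ʳ a) (σ ⟨$⟩ʳ b) (σ ⟨$⟩ʳ c)
Rule-permute σ rule with Rule-distinct rule
... | a≢b , b≢c , a≢c = distinct-Rule _ _ _
  (λ eq → a≢b (injective eq)) (λ eq → b≢c (injective eq)) (λ eq → a≢c (injective eq))
  where open Injection (↔⇒↣ σ) using (injective)

relabel : Permutation′ 3 → ∀ {t} → Labeling t → Labeling t
relabel σ (leaf a)     = leaf (σ ⟨$⟩ʳ a)
relabel σ (node a x y) = node (σ ⟨$⟩ʳ a) (relabel σ x) (relabel σ y)

rootLabel-relabel : ∀ σ {t} (x : Labeling t) → rootLabel (relabel σ x) ≡ σ ⟨$⟩ʳ rootLabel x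
rootLabel-relabel σ (leaf _)     = refl
rootLabel-relabel σ (node _ _ _) = refl

leafWord-relabel : ∀ σ {t} (x : Labeling t) → leafWord (relabel σ x) ≡ permute σ (leafWord x)
leafWord-relabel σ (leaf _)     = refl
leafWord-relabel σ (node _ x y) = trans
  (cong₂ _++_ (leafWord-relabel σ x) (leafWord-relabel σ y))
  (sym (map-++ (σ ⟨$⟩ʳ_) (leafWord x) (leafWord y)))

Valid-relabel : ∀ σ {t} (x : Labeling t) → Valid x → Valid (relabel σ x)
Valid-relabel σ (leaf _)     _ = tt
Valid-relabel σ (node a x y) (rule , vx , vy)
  rewrite rootLabel-relabel σ x | rootLabel-relabel σ y =
  Rule-permute σ rule , Valid-relabel σ x vx , Valid-relabel σ y vy

Parses-resp : ∀ t → Parses t Respects _∼_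
Parses-resp t (σ , refl) (x , refl , v) =
  relabel σ x , leafWord-relabel σ x , Valid-relabel σ x v

ParseWords-resp : ∀ t₁ t₂ → ParseWords t₁ t₂ Respects _∼_
ParseWords-resp t₁ t₂ u∼v (p₁ , p₂) = Parses-resp t₁ u∼v p₁ , Parses-resp t₂ u∼v p₂

data Dir : Set where
  l r : Dir

-- The j-th direction (counting from 1) says which of the two vertices on
-- level j has children, so a word of length N - 2 gives a tree with N leaves.
pathTree : List Dir → Tree
pathTree []       = node leaf leaf
pathTree (l ∷ xs) = node (pathTree xs) leaf
pathTree (r ∷ xs) = node leaf (pathTree xs)

-- Number of vertices at distance k from the root.
levelSize : ℕ → Tree → ℕ
levelSize zero    _          = 1
levelSize (suc _) leaf       = 0
levelSize (suc k) (node s t) = levelSize k s + levelSize k t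

IsPathTree : Tree → Set
IsPathTree t = ∀ k → levelSize k t ≤ 2

pathTree-isPathTree : ∀ xs → IsPathTree (pathTree xs)
pathTree-isPathTree _        zero          = s≤s z≤n
pathTree-isPathTree []       1             = s≤s (s≤s z≤n)
pathTree-isPathTree []       (suc (suc _)) = z≤n
pathTree-isPathTree (l ∷ xs) 1             = s≤s (s≤s z≤n)
pathTree-isPathTree (l ∷ xs) (suc (suc k))
  rewrite +-identityʳ (levelSize (suc k) (pathTree xs)) = pathTree-isPathTree xs (suc k)
pathTree-isPathTree (r ∷ xs) 1             = s≤s (s≤s z≤n)
pathTree-isPathTree (r ∷ xs) (suc (suc k)) = pathTree-isPathTree xs (suc k)

leaves-pathTree : ∀ xs → leaves (pathTree xs) ≡ length xs + 2
leaves-pathTree []       = refl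
leaves-pathTree (l ∷ xs) = trans (+-comm _ 1) (cong suc (leaves-pathTree xs))
leaves-pathTree (r ∷ xs) = cong suc (leaves-pathTree xs)

-- Both are meant for n ≥ 2 only, because of the truncated subtraction.
leftTurnTree rightTurnTree : ℕ → ℕ → Tree
leftTurnTree  m n = pathTree (replicate m l ++ replicate (n ∸ 2) r)
rightTurnTree m n = pathTree (replicate m r ++ replicate (n ∸ 2) l)

private
  leaves-turn : ∀ d e m {n} → 2 ≤ n →
    leaves (pathTree (replicate m d ++ replicate (n ∸ 2) e)) ≡ m + n
  leaves-turn d e m {n} 2≤n = begin
    leaves (pathTree (replicate m d ++ replicate (n ∸ 2) e))
      ≡⟨ leaves-pathTree (replicate m d ++ replicate (n ∸ 2) e) ⟩
    length (replicate m d ++ replicate (n ∸ 2) e) + 2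
      ≡⟨ cong (_+ 2) (length-++ (replicate m d)) ⟩
    length (replicate m d) + length (replicate (n ∸ 2) e) + 2
      ≡⟨ cong (_+ 2) (cong₂ _+_ (length-replicate m) (length-replicate (n ∸ 2))) ⟩
    m + (n ∸ 2) + 2
      ≡⟨ +-assoc m (n ∸ 2) 2 ⟩
    m + (n ∸ 2 + 2)
      ≡⟨ cong (m +_) (m∸n+n≡m 2≤n) ⟩
    m + n ∎
    where open ≡-Reasoning

leaves-leftTurnTree : ∀ m {n} → 2 ≤ n → leaves (leftTurnTree m n) ≡ m + n
leaves-leftTurnTree = leaves-turn l r

leaves-rightTurnTree : ∀ m {n} → 2 ≤ n → leaves (rightTurnTree m n) ≡ m + n
leaves-rightTurnTree = leaves-turn r l

-- Along the common word v₁ ⋯ v_{m+n}, compare the labels met when climbing the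
-- two path trees.  Let s be the label over v₂ ⋯ v_n in the left turn tree.  For
-- 2 ≤ i < n, the label c over v₂ ⋯ v_i in the right turn tree and the label d
-- over v_{i+1} ⋯ v_n in the left turn tree are the two letters other than s.
-- If i + 1 < n, the next letter differs from both, so it is s, and c and d are
-- exchanged; hence v_n is the last d.  After v_n the running labels of the two
-- trees are the two letters other than v₁, and the same argument makes every
-- later letter equal to v₁.
module Submission where

open import Defs
open import Data.Nat.Base using (ℕ; zero; suc; _+_; _∸_; _≤_; z≤n; s≤s)
open import Data.Nat.Properties using (+-∸-assoc; +-comm; +-suc; ∸-+-assoc; suc-injective)
open import Data.Nat.Divisibility using (_∣_; _∤_; divides-refl; ∣m∣n⇒∣m+n; ∣m+n∣m⇒∣n; ∣-refl; ∣1⇒≡1)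
open import Data.Fin.Patterns using (0F; 1F; 2F)
open import Data.Fin.Permutation as Perm using (Permutation′; _⟨$⟩ʳ_; _∘ₚ_)
open import Data.List.Base using (List; []; _∷_; _++_; [_]; replicate; length)
open import Data.List.Properties
  using (++-assoc; ++-identityʳ; length-++; length-replicate; map-++; map-replicate)
open import Data.List.Relation.Unary.Any using (here; there)
open import Data.Product.Base using (_×_; _,_; ∃-syntax; Σ-syntax; proj₁; proj₂)
open import Data.Unit.Base using (tt)
open import Relation.Nullary.Negation using (contradiction)
open import Relation.Binary.PropositionalEquality
  using (_≡_; _≢_; refl; sym; trans; cong; cong₂; subst; ≢-sym)
open import Relation.Unary using (Pred; _≐_)

private variable
  a b c d q s x y : Letter
  u v w           : Word

-- Symmetries of the production rules

Rule-swap : Rule a b c → Rule a c b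
Rule-swap rule with Rule-distinct rule
... | a≢b , b≢c , a≢c = distinct-Rule _ _ _ a≢c (≢-sym b≢c) a≢b

Rule-rotate : Rule a b c → Rule b c a
Rule-rotate rule with Rule-distinct rule
... | a≢b , b≢c , a≢c = distinct-Rule _ _ _ b≢c (≢-sym a≢c) (≢-sym a≢b)

Rule-reverse : Rule a b c → Rule c b a
Rule-reverse rule = Rule-rotate (Rule-swap rule)

Rule-unique : Rule a b c → Rule x b c → x ≡ a
Rule-unique 0→12 0→12 = refl
Rule-unique 0→21 0→21 = refl
Rule-unique 1→02 1→02 = refl
Rule-unique 1→20 1→20 = refl
Rule-unique 2→01 2→01 = refl
Rule-unique 2→10 2→10 = refl

Rule-third : Rule a b c → x ≢ b → x ≢ c → x ≡ a
Rule-third rule x≢b x≢c = Rule-unique rule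
  (distinct-Rule _ _ _ x≢b (proj₁ (proj₂ (Rule-distinct rule))) x≢c)

-- The rule makes `a` and `s` distinct, so some permutation of the alphabet sends them to 0 and 1;
-- this selects the representative of a class.
normalise : Rule q a s → Σ[ σ ∈ Permutation′ 3 ] (σ ⟨$⟩ʳ a ≡ 0F × σ ⟨$⟩ʳ s ≡ 1F)
normalise 0→12 = Perm.transpose 0F 1F ∘ₚ Perm.transpose 1F 2F , refl , refl
normalise 0→21 = Perm.transpose 0F 2F , refl , refl
normalise 1→02 = Perm.transpose 1F 2F , refl , refl
normalise 1→20 = Perm.transpose 0F 1F ∘ₚ Perm.transpose 0F 2F , refl , refl
normalise 2→01 = Perm.id , refl , refl
normalise 2→10 = Perm.transpose 0F 1F , refl , refl

-- Parsing along combs and spines as folds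

ParsesTo : Tree → Word → Letter → Set
ParsesTo t w a = Σ[ x ∈ Labeling t ] (leafWord x ≡ w × rootLabel x ≡ a × Valid x)

parsesTo-cong : ∀ {xs ys} → xs ≡ ys → ParsesTo (pathTree xs) w a → ParsesTo (pathTree ys) w a
parsesTo-cong refl p = p

-- Climbing a left spine: the first index is the label at the bottom, the last one the label at the
-- top, and the word lists the right leaves passed on the way.
data LeftFold : Letter → Word → Letter → Set where
  []  : LeftFold a [] a
  _∷_ : Rule b a x → LeftFold b w c → LeftFold a (x ∷ w) c

-- A single letter is allowed, so every nonempty suffix of the leaves of a right comb has a fold.
data RightFold : Word → Letter → Set where
  [-] : RightFold [ a ] a
  _∷_ : Rule c a b → RightFold w b → RightFold (a ∷ w) c

replicate-shift : ∀ {A : Set} m (y : A) ys → replicate m y ++ y ∷ ys ≡ y ∷ replicate m y ++ ys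
replicate-shift zero    y ys = refl
replicate-shift (suc m) y ys = cong (y ∷_) (replicate-shift m y ys)

parsesTo-rightComb⁻ : ∀ k → ParsesTo (pathTree (replicate k r)) w a →
  RightFold w a × length w ≡ 2 + k
parsesTo-rightComb⁻ zero (node _ (leaf _) (leaf _) , refl , refl , rule , _) =
  (rule ∷ [-]) , refl
parsesTo-rightComb⁻ (suc k) (node _ (leaf _) y , refl , refl , rule , _ , vy)
  with parsesTo-rightComb⁻ k (y , refl , refl , vy)
... | fold , eq = (rule ∷ fold) , cong suc eq

parsesTo-rightComb⁺ : ∀ k → RightFold w a → length w ≡ 2 + k →
  ParsesTo (pathTree (replicate k r)) w a
parsesTo-rightComb⁺ zero (rule ∷ [-]) _ =
  node _ (leaf _) (leaf _) , refl , refl , rule , tt , tt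
parsesTo-rightComb⁺ zero (_ ∷ _ ∷ [-]) ()
parsesTo-rightComb⁺ (suc k) (rule ∷ fold) eq
  with parsesTo-rightComb⁺ k fold (suc-injective eq)
... | y , refl , refl , vy = node _ (leaf _) y , refl , refl , rule , tt , vy

-- The fold starts at the bottom of the spine, whereas the tree is built from the top. Hence the
-- induction moves one `l` from the spine into `xs`; the leaf this adds is the first letter of the
-- fold.
parsesTo-leftSpine⁻ : ∀ m xs → ParsesTo (pathTree (replicate m l ++ xs)) w b →
  ∃[ u ] ∃[ v ] ∃[ a ] (w ≡ u ++ v × length v ≡ m × ParsesTo (pathTree xs) u a × LeftFold a v b)
parsesTo-leftSpine⁻ {w} zero xs p = w , [] , _ , sym (++-identityʳ w) , refl , p , []
parsesTo-leftSpine⁻ (suc m) xs p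
  with parsesTo-leftSpine⁻ m (l ∷ xs)
         (parsesTo-cong (sym (replicate-shift m l xs)) p)
... | _ , v , _ , refl , eq , (node _ y (leaf x) , refl , refl , rule , vy , _) , fold =
  leafWord y , x ∷ v , _ , ++-assoc (leafWord y) [ x ] v , cong suc eq ,
  (y , refl , refl , vy) , (rule ∷ fold)

parsesTo-leftSpine⁺ : ∀ m xs → ParsesTo (pathTree xs) u a → LeftFold a v b → length v ≡ m →
  ParsesTo (pathTree (replicate m l ++ xs)) (u ++ v) b
parsesTo-leftSpine⁺ {u} zero xs p [] _ = subst (λ w → ParsesTo _ w _) (sym (++-identityʳ u)) p
parsesTo-leftSpine⁺ {v = x ∷ v} (suc m) xs (y , refl , refl , vy) (rule ∷ fold) eq
  with parsesTo-leftSpine⁺ m (l ∷ xs)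
         (node _ y (leaf x) , refl , refl , rule , vy , tt) fold (suc-injective eq)
... | p rewrite replicate-shift m l xs | ++-assoc (leafWord y) [ x ] v = p

parses-rightTurn⁻ : ∀ j → Parses (pathTree (r ∷ replicate j l)) w →
  ∃[ a ] ∃[ b ] ∃[ c ] ∃[ u ] (w ≡ a ∷ b ∷ u × LeftFold b u c)
parses-rightTurn⁻ j (node _ (leaf a) y , refl , _ , _ , vy)
  with parsesTo-leftSpine⁻ j []
         (parsesTo-cong (sym (++-identityʳ (replicate j l))) (y , refl , refl , vy))
-- The lowest internal vertex has two leaves: the left one is the starting label of the fold, the
-- right one its first letter.
... | _ , v , _ , eq , _ , (node _ (leaf b) (leaf x) , refl , refl , rule , _) , fold =
  a , b , _ , x ∷ v , cong (a ∷_) eq , (rule ∷ fold)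

parses-rightTurn⁺ : ∀ j → Rule d a c → LeftFold b u c → length u ≡ suc j →
  Parses (pathTree (r ∷ replicate j l)) (a ∷ b ∷ u)
parses-rightTurn⁺ j root (rule ∷ fold) eq
  with parsesTo-leftSpine⁺ j [] (node _ (leaf _) (leaf _) , refl , refl , rule , tt , tt)
         fold (suc-injective eq)
... | p with parsesTo-cong (++-identityʳ (replicate j l)) p
... | y , eq′ , refl , vy = node _ (leaf _) y , cong (_ ∷_) eq′ , root , tt , vy

-- Exchange of the running labels

alternate : ∀ {A : Set} → ℕ → A → A → A
alternate zero    c d = d
alternate (suc k) c d = alternate k d c

alternate-map : ∀ {A B : Set} (f : A → B) k c d → f (alternate k c d) ≡ alternate k (f c) (f d)
alternate-map f zero    c d = refl
alternate-map f (suc k) c d = alternate-map f k d c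

-- The middle exponent is k = n - 3, so the parities of k and n are opposite.
alternate-odd : ∀ {A : Set} k {c d : A} → 2 ∣ 3 + k → alternate k c d ≡ c
alternate-odd zero          2∣3 with () ← ∣1⇒≡1 (∣m+n∣m⇒∣n {2} {2} 2∣3 ∣-refl)
alternate-odd 1             _   = refl
alternate-odd (suc (suc k)) 2∣n = alternate-odd k (∣m+n∣m⇒∣n 2∣n ∣-refl)

alternate-even : ∀ {A : Set} k {c d : A} → 2 ∤ 3 + k → alternate k c d ≡ d
alternate-even zero          _   = refl
alternate-even 1             2∤4 = contradiction (divides-refl 2) 2∤4
alternate-even (suc (suc k)) 2∤n = alternate-even k (λ 2∣n → 2∤n (∣m∣n⇒∣m+n ∣-refl 2∣n))

-- Here `w` is the part up to v_n still to be read, and `alternate k c d` is the `d` left after `k`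
-- exchanges. The last step joins `c` and `d`, so the right turn tree also has label `s` over v₂ ⋯
-- v_n, and the fold over `v` starts there.
middle-forced : ∀ k → Rule s c d → RightFold w d → LeftFold c (w ++ v) b → length w ≡ suc k →
  w ≡ replicate k s ++ [ alternate k c d ] × LeftFold s v b
middle-forced zero rule [-] (rule′ ∷ fold) _ with refl ← Rule-unique rule rule′ = refl , fold
middle-forced zero _ (_ ∷ [-]) _ ()
middle-forced zero _ (_ ∷ _ ∷ _) _ ()
middle-forced (suc k) rule (ruleʳ ∷ foldʳ) (ruleˡ ∷ foldˡ) eq
  -- The letter differs from `c` by `ruleˡ` and from `d` by `ruleʳ`.
  with refl ← Rule-third rule
         (≢-sym (proj₁ (proj₂ (Rule-distinct ruleˡ))))
         (≢-sym (proj₁ (Rule-distinct ruleʳ)))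
  with refl ← Rule-unique (Rule-reverse rule) ruleˡ
  with refl ← Rule-unique (Rule-rotate rule) (Rule-rotate (Rule-rotate ruleʳ))
  with middle-forced k (Rule-swap rule) foldʳ foldˡ (suc-injective eq)
... | refl , fold = refl , fold

middle-rightFold : ∀ k → Rule s c d → RightFold (replicate k s ++ [ alternate k c d ]) d
middle-rightFold zero    rule = [-]
middle-rightFold (suc k) rule =
  Rule-rotate (Rule-rotate rule) ∷ middle-rightFold k (Rule-swap rule)

middle-leftFold : ∀ k → Rule s c d → LeftFold s v b →
  LeftFold c (replicate k s ++ alternate k c d ∷ v) b
middle-leftFold zero    rule fold = rule ∷ fold
middle-leftFold (suc k) rule fold =
  Rule-reverse rule ∷ middle-leftFold k (Rule-swap rule) fold

-- A letter read by both folds differs from `c` and from `d`, so it is `a`; reading it turns `c`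
-- into `d` and `d` into `c`.
tail-forced : Rule a c d → LeftFold c v b → LeftFold d v x → v ≡ replicate (length v) a
tail-forced rule [] [] = refl
tail-forced rule (rule₁ ∷ fold₁) (rule₂ ∷ fold₂)
  with refl ← Rule-third rule
         (≢-sym (proj₁ (proj₂ (Rule-distinct rule₁))))
         (≢-sym (proj₁ (proj₂ (Rule-distinct rule₂))))
  with refl ← Rule-unique (Rule-reverse rule) rule₁
  with refl ← Rule-unique (Rule-reverse (Rule-swap rule)) rule₂
  = cong (_ ∷_) (tail-forced (Rule-swap rule) fold₁ fold₂)

tail-leftFold : ∀ m → Rule a c d → LeftFold c (replicate m a) (alternate m d c)
tail-leftFold zero    rule = []
tail-leftFold (suc m) rule = Rule-reverse rule ∷ tail-leftFold m (Rule-swap rule)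

-- This supplies the rule at the root of the right turn tree, whose left child is v₁ = `a`: the
-- label reached from `c` at the root of the left turn tree serves as its root label too.
tail-root : ∀ m → Rule a c d → Rule (alternate m d c) a (alternate m c d)
tail-root zero    rule = Rule-swap (Rule-rotate rule)
tail-root (suc m) rule = tail-root m (Rule-swap rule)

turnWord : ℕ → ℕ → Letter → Letter → Letter → Letter → Word
turnWord m k a s c d = a ∷ c ∷ replicate k s ++ alternate k c d ∷ replicate m a

permute-turnWord : ∀ σ m k a s c d → permute σ (turnWord m k a s c d) ≡
  turnWord m k (σ ⟨$⟩ʳ a) (σ ⟨$⟩ʳ s) (σ ⟨$⟩ʳ c) (σ ⟨$⟩ʳ d)
permute-turnWord σ m k a s c d = cong (λ u → (σ ⟨$⟩ʳ a) ∷ (σ ⟨$⟩ʳ c) ∷ u) (trans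
  (map-++ (σ ⟨$⟩ʳ_) (replicate k s) _)
  (cong₂ _++_ (map-replicate (σ ⟨$⟩ʳ_) k s)
    (cong₂ _∷_ (alternate-map (σ ⟨$⟩ʳ_) k c d) (map-replicate (σ ⟨$⟩ʳ_) m a))))

rightTurnTree-turns : ∀ m k →
  rightTurnTree 1 (m + (3 + k) ∸ 1) ≡ pathTree (r ∷ replicate (m + k) l)
rightTurnTree-turns m k = cong (λ j → pathTree (r ∷ replicate j l))
  (trans (∸-+-assoc (m + (3 + k)) 1 2) (+-∸-assoc m {3 + k} {3} (s≤s (s≤s (s≤s z≤n)))))

-- Normalising v₁ to 0 and the label over v₂ ⋯ v_n to 1 leaves only the choice of a rule for 1; its
-- two values give the two classes.
TurnClass : ℕ → ℕ → Pred Word _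
TurnClass m k w = ∃[ c ] ∃[ d ] (Rule 1F c d × w ∼ turnWord m k 0F 1F c d)

turnWord-turnClass : ∀ m k → Rule q a s → Rule s c d → TurnClass m k (turnWord m k a s c d)
turnWord-turnClass {a = a} {s} {c} {d} m k rule₁ rule₂ with normalise rule₁
... | σ , σa≡0 , σs≡1 =
  c′ , d′ , subst (λ y → Rule y c′ d′) σs≡1 (Rule-permute σ rule₂) ,
  σ , trans (permute-turnWord σ m k a s c d)
        (cong₂ (λ y z → turnWord m k y z c′ d′) σa≡0 σs≡1)
  where
  c′ = σ ⟨$⟩ʳ c
  d′ = σ ⟨$⟩ʳ d

parseWords⇒turnClass : ∀ m k →
  ParseWords (leftTurnTree m (3 + k)) (rightTurnTree 1 (m + (3 + k) ∸ 1)) w → TurnClass m k w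
parseWords⇒turnClass m k ((x , eq , vx) , p₂)
  rewrite rightTurnTree-turns m k
  with _ , v , _ , refl , refl , pu , foldˡ ←
         parsesTo-leftSpine⁻ m (replicate (suc k) r) (x , eq , refl , vx)
  with parsesTo-rightComb⁻ (suc k) pu
... | (_ ∷ [-]) , ()
-- `rule₁` is the rule at the vertex over v₁ ⋯ v_n in the left turn tree, `rule₂` the one over v₂ ⋯
-- v_n.
... | (rule₁ ∷ _∷_ {a = c} {b = d} rule₂ foldʳ) , |u|≡n
  with _ , _ , _ , _ , refl , foldˡ′ ← parses-rightTurn⁻ (m + k) p₂
  with refl , foldˡ″ ← middle-forced k rule₂ foldʳ foldˡ′ (suc-injective (suc-injective |u|≡n))
  = subst (TurnClass m k)
      (cong (λ u → _ ∷ c ∷ u) (trans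
        (cong (λ v → replicate k _ ++ alternate k c d ∷ v)
          -- By `rule₁`, v₁ and the labels of the two trees just after v_n are pairwise distinct.
          (sym (tail-forced (Rule-swap (Rule-rotate rule₁)) foldˡ foldˡ″)))
        (sym (++-assoc (replicate k _) [ alternate k c d ] v))))
      (turnWord-turnClass m k rule₁ rule₂)

turnClass⇒parseWords : ∀ m k → TurnClass m k w →
  ParseWords (leftTurnTree m (3 + k)) (rightTurnTree 1 (m + (3 + k) ∸ 1)) w
turnClass⇒parseWords m k (c , d , rule , w∼word) =
  ParseWords-resp (leftTurnTree m (3 + k)) (rightTurnTree 1 (m + (3 + k) ∸ 1))
    (∼-sym w∼word) (parses₁ , parses₂)
  where
  e = alternate k c d

  parses₁ : Parses (leftTurnTree m (3 + k)) (turnWord m k 0F 1F c d)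
  parses₁ with parsesTo-leftSpine⁺ m (replicate (suc k) r)
    -- With v₁ = 0 and label 1 over v₂ ⋯ v_n, the label over v₁ ⋯ v_n is 2, where the tail of this
    -- tree starts.
    (parsesTo-rightComb⁺ (suc k) (2→01 ∷ rule ∷ middle-rightFold k rule)
      (cong (2 +_) (trans (length-++ (replicate k 1F))
        (trans (cong (_+ 1) (length-replicate k)) (+-comm k 1)))))
    (tail-leftFold m 0→21) (length-replicate m)
  ... | x , eq , _ , vx =
    x , trans eq (cong (λ u → 0F ∷ c ∷ u) (++-assoc (replicate k 1F) [ e ] _)) , vx

  parses₂ : Parses (rightTurnTree 1 (m + (3 + k) ∸ 1)) (turnWord m k 0F 1F c d)
  parses₂ rewrite rightTurnTree-turns m k =
    parses-rightTurn⁺ (m + k) (tail-root m 0→21)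
      -- In the right turn tree the tail starts from 1, the label over v₂ ⋯ v_n.
      (middle-leftFold k rule (tail-leftFold m 0→12))
      (trans (length-++ (replicate k 1F))
        (trans (cong₂ (λ i j → i + suc j) (length-replicate k) (length-replicate m))
          (trans (+-suc k m) (cong suc (+-comm k m)))))

-- Keeping `x` and `y` as variables treats both parities at once; they are the letters v_n for v₂ =
-- 0 and v₂ = 2.
parseWords≐classesOf : ∀ m k → alternate k 0F 2F ≡ x → alternate k 2F 0F ≡ y →
  ParseWords (leftTurnTree m (3 + k)) (rightTurnTree 1 (m + (3 + k) ∸ 1)) ≐ classesOf
    ( (0F ∷ 0F ∷ replicate k 1F ++ x ∷ replicate m 0F)
    ∷ (0F ∷ 2F ∷ replicate k 1F ++ y ∷ replicate m 0F)
    ∷ [] )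
parseWords≐classesOf m k refl refl =
  (λ p → to (parseWords⇒turnClass m k p)) , (λ p → turnClass⇒parseWords m k (from p))
  where
  to : TurnClass m k w → classesOf _ w
  to (_ , _ , 1→02 , eqv) = here eqv
  to (_ , _ , 1→20 , eqv) = there (here eqv)

  from : classesOf _ w → TurnClass m k w
  from (here eqv)         = _ , _ , 1→02 , eqv
  from (there (here eqv)) = _ , _ , 1→20 , eqv

classesOf-swap : classesOf (u ∷ v ∷ []) w → classesOf (v ∷ u ∷ []) w
classesOf-swap (here eqv)         = there (here eqv)
classesOf-swap (there (here eqv)) = here eqv

theorem5 : (m n : ℕ) → 1 ≤ m → 3 ≤ n →
    (2 ∤ n →
    ParseWords (leftTurnTree m n) (rightTurnTree 1 (m + n ∸ 1)) ≐ classesOf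
    ( (0F ∷ 0F ∷ replicate (n ∸ 3) 1F ++ 2F ∷ replicate m 0F)
    ∷ (0F ∷ 2F ∷ replicate (n ∸ 3) 1F ++ 0F ∷ replicate m 0F)
    ∷ [] ))
    ×
    (4 ≤ n → 2 ∣ n →
    ParseWords (leftTurnTree m n) (rightTurnTree 1 (m + n ∸ 1)) ≐ classesOf
    ( (0F ∷ 2F ∷ replicate (n ∸ 3) 1F ++ 2F ∷ replicate m 0F)
    ∷ (0F ∷ 0F ∷ replicate (n ∸ 3) 1F ++ 0F ∷ replicate m 0F)
    ∷ [] ))
theorem5 m (suc (suc (suc k))) _ (s≤s (s≤s (s≤s z≤n))) =
  (λ 2∤n → parseWords≐classesOf m k (alternate-even k 2∤n) (alternate-even k 2∤n)) ,
  -- For even `n` the word with v₂ = 2 is listed first, hence the swap.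
  λ _ 2∣n → let to , from = parseWords≐classesOf m k (alternate-odd k 2∣n) (alternate-odd k 2∣n)
    in (λ p → classesOf-swap (to p)) , (λ p → from (classesOf-swap p))
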